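{- Let $\mathcal{L}\subseteq\mathrm{Scat}$ be nonempty, downward $\preceq$-closed and ccs. Then in the quasi-order $\trianglelefteq^{\mathcal{L}}_{\mathrm{LO}}$ there are chains of order type $(\mathbb{R},<)$ and antichains of size $2^{\aleph_0}$.
   Context: Linear orders are reflexive and nonempty. $L\preceq L'$ means there is an embedding $f:L\to L'$, i.e. $x\le_L y\iff f(x)\le_{L'}f(y)$. $\mathrm{LO}\subseteq 2^{\mathbb{N}\times\mathbb{N}}$ is the set of (codes for) linear orders with domain $\mathbb{N}$; $\mathrm{Fin}$ is the set of (codes for) nonempty linear orders on finite subsets of $\mathbb{N}$; $\mathrm{Lin}=\mathrm{Fin}\cup\mathrm{LO}$; $\mathrm{Scat}\subseteq\mathrm{Lin}$ is the set of scattered ones (those $L$ with $\mathbb{Q}\not\preceq L$). A class $\mathcal{L}\subseteq\mathrm{Lin}$ is downward $\preceq$-closed if $K\in\mathrm{Lin}$ and $K\preceq L\in\mathcal{L}$ imply $K\in\mathcal{L}$; membership in $\mathcal{L}$ is meant up to isomorphism. A subset $I$ of a linear order $L$ is convex if $x\le_L y\le_L z$ and $x,z\in I$ imply $y\in I$. For $A,B\subseteq L$ write $A\le_L B$ (resp. $A<_L B$) if $a\le_L b$ (resp. $a<_L b$) for all $a\in A$, $b\in B$. A $K$-convex partition of $L$ is a partition $(L_k)_{k\in K}$ of $L$ (into nonempty sets) such that $k<_K k'\iff L_k<_L L_{k'}$. The relation $L\trianglelefteq^{\mathcal{L}}L'$ holds iff there are $K\in\mathcal{L}$, a $K$-convex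 partition $(L_k)_{k\in K}$ of $L$, and an embedding $f$ of $L$ into $L'$ such that $f(L_k)$ is a convex subset of $L'$ for every $k\in K$. $\trianglelefteq^{\mathcal{L}}_{\mathrm{LO}}$ is its restriction to $\mathrm{LO}$. $\mathcal{L}$ is ccs (closed under convex sums) if for all $K,K'\in\mathcal{L}$ and every family $(K'_k)_{k\in K}$ of nonempty convex subsets of $K'$ such that $k_0<_K k_1\Rightarrow K'_{k_0}\le_{K'}K'_{k_1}$, we have $\sum_{k\in K}K'_k\in\mathcal{L}$, where $\sum_{k\in K}K'_k=\{(x,k): k\in K, x\in K'_k\}$ ordered antilexicographically. When $\mathcal{L}$ is ccs, $\trianglelefteq^{\mathcal{L}}$ is a quasi-order. A chain of order type $(\mathbb{R},<)$ is a family $(L_x)_{x\in\mathbb{R}}$ in $\mathrm{LO}$ with $L_x\trianglelefteq^{\mathcal{L}}_{\mathrm{LO}}L_y\iff x\le y$; an antichain is a set of pairwise $\trianglelefteq^{\mathcal{L}}_{\mathrm{LO}}$-incomparable elements. -}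

module Defs where

open import Data.Bool using (Bool; T)
open import Data.Bool.Properties using (T-irrelevant; T?)
open import Data.List using (List; [])
open import Data.List.Membership.Propositional using () renaming (_∈_ to _∈ˡ_)
open import Data.Nat using (ℕ)
import Data.Nat.Properties as ℕ
open import Data.Product using (Σ; Σ-syntax; ∃; ∃-syntax; _×_; _,_; proj₁; proj₂; swap)
open import Data.Product.Relation.Binary.Lex.NonStrict using (×-totalOrder)
open import Data.Rational using (ℚ) renaming (_≤_ to _≤ℚ_; _<_ to _<ℚ_)
import Data.Rational.Properties as ℚ
open import Data.Sum using (_⊎_; inj₁; inj₂)
open import Function using (_∘_; _⇔_; Bijection; Func)
open import Level using (Level; 0ℓ; _⊔_) renaming (suc to lsuc)
open import Relation.Binary using (DecTotalOrder; Setoid; TotalOrder)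
import Relation.Binary.Construct.On as On
open import Relation.Binary.Morphism.Structures
  using (IsOrderIsomorphism; IsOrderMonomorphism)
open import Relation.Binary.PropositionalEquality
  using (_≡_; _≢_; refl; sym; trans; cong; isEquivalence; _→-setoid_)
open import Relation.Nullary using (Dec; ¬_; yes; no)
open import Relation.Unary using (Pred; _∈_; _⊆_; U; Satisfiable)

private
  variable
    ℓ : Level

LinearOrder : Set₁
LinearOrder = TotalOrder 0ℓ 0ℓ 0ℓ

open TotalOrder using (Carrier)

infix 4 _≼_ _≅_

-- The components `mono` and `cancel` of IsOrderMonomorphism are the two
-- directions of x ≤ y ⇔ f x ≤ f y.

IsEmbedding : (L L′ : LinearOrder) → (Carrier L → Carrier L′) → Set
IsEmbedding L L′ = IsOrderMonomorphism L._≈_ L′._≈_ L._≤_ L′._≤_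
  where module L = TotalOrder L
        module L′ = TotalOrder L′

_≼_ : LinearOrder → LinearOrder → Set
L ≼ L′ = ∃[ f ] IsEmbedding L L′ f

_≅_ : LinearOrder → LinearOrder → Set
L ≅ L′ = ∃[ f ] IsOrderIsomorphism L._≈_ L′._≈_ L._≤_ L′._≤_ f
  where module L = TotalOrder L
        module L′ = TotalOrder L′

module _ (L : LinearOrder) where
  open TotalOrder L using (_≈_; _≤_)

  Strictly : Carrier L → Carrier L → Set
  Strictly x y = x ≤ y × ¬ (x ≈ y)

  IsConvex : Pred (Carrier L) 0ℓ → Set
  IsConvex I = ∀ {x y z} → x ≤ y → y ≤ z → x ∈ I → z ∈ I → y ∈ I

  AllBelow : (A B : Pred (Carrier L) 0ℓ) → Set
  AllBelow A B = ∀ {a b} → a ∈ A → b ∈ B → a ≤ b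

  AllStrictlyBelow : (A B : Pred (Carrier L) 0ℓ) → Set
  AllStrictlyBelow A B = ∀ {a b} → a ∈ A → b ∈ B → Strictly a b

Image : (L L′ : LinearOrder) → (Carrier L → Carrier L′) →
        Pred (Carrier L) 0ℓ → Pred (Carrier L′) 0ℓ
Image L L′ f A y = ∃[ x ] x ∈ A × TotalOrder._≈_ L′ (f x) y

record IsConvexPartition (K L : LinearOrder)
                         (P : Carrier K → Pred (Carrier L) 0ℓ) : Set where
  private
    module K = TotalOrder K
    module L = TotalOrder L
  field
    respectsIndex : ∀ {k k′ x} → k K.≈ k′ → x ∈ P k → x ∈ P k′
    respects      : ∀ {k x y} → x L.≈ y → x ∈ P k → y ∈ P k
    nonempty      : ∀ k → Satisfiable (P k)
    covers        : ∀ x → ∃[ k ] x ∈ P k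
    disjoint      : ∀ {k k′ x} → x ∈ P k → x ∈ P k′ → k K.≈ k′
    ordered       : ∀ k k′ → Strictly K k k′ ⇔ AllStrictlyBelow L (P k) (P k′)

-- An element R of 2^(ℕ×ℕ); R m n is the truth value of "m ≤ n".

Code : Set
Code = ℕ → ℕ → Bool

record IsLinearOn (D : Pred ℕ 0ℓ) (R : Code) : Set where
  field
    support : ∀ {m n} → T (R m n) → m ∈ D × n ∈ D
    reflx   : ∀ {n} → n ∈ D → T (R n n)
    antisym : ∀ {m n} → T (R m n) → T (R n m) → m ≡ n
    transit : ∀ {l m n} → T (R l m) → T (R m n) → T (R l n)
    total   : ∀ {m n} → m ∈ D → n ∈ D → T (R m n) ⊎ T (R n m)

IsLO : Pred Code 0ℓ
IsLO R = IsLinearOn U R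

IsFin : Pred Code 0ℓ
IsFin R = Σ[ xs ∈ List ℕ ] xs ≢ [] × IsLinearOn (_∈ˡ xs) R

LO : Set
LO = Σ Code IsLO

Lin : Set
Lin = Σ Code (λ R → IsFin R ⊎ IsLO R)

LO⇒Lin : LO → Lin
LO⇒Lin (R , lo) = R , inj₂ lo

-- The domain of a code is recovered as { n | R n n }.

decOrder : Lin → DecTotalOrder 0ℓ 0ℓ 0ℓ
decOrder (R , lin) = record
  { Carrier = Dom
  ; _≈_ = _≡_
  ; _≤_ = λ x y → T (R (proj₁ x) (proj₁ y))
  ; isDecTotalOrder = record
    { isTotalOrder = record
      { isPartialOrder = record
        { isPreorder = record
          { isEquivalence = isEquivalence
          ; reflexive = λ { {x} refl → proj₂ x }
          ; trans = transit′ lin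
          }
        ; antisym = λ p q → Dom-≡ (antisym′ lin p q)
        }
      ; total = λ x y → total′ lin (proj₂ x) (proj₂ y)
      }
    ; _≟_ = dec
    ; _≤?_ = λ x y → T? (R (proj₁ x) (proj₁ y))
    }
  }
  where
  open IsLinearOn

  Dom : Set
  Dom = Σ[ n ∈ ℕ ] T (R n n)

  Dom-≡ : {x y : Dom} → proj₁ x ≡ proj₁ y → x ≡ y
  Dom-≡ {n , p} {.n , q} refl = cong (n ,_) (T-irrelevant p q)

  dec : (x y : Dom) → Dec (x ≡ y)
  dec x y with proj₁ x ℕ.≟ proj₁ y
  ... | yes eq = yes (Dom-≡ eq)
  ... | no neq = no (λ eq → neq (cong proj₁ eq))

  transit′ : IsFin R ⊎ IsLO R → ∀ {l m n} → T (R l m) → T (R m n) → T (R l n)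
  transit′ (inj₁ (_ , _ , lo)) = transit lo
  transit′ (inj₂ lo)           = transit lo

  antisym′ : IsFin R ⊎ IsLO R → ∀ {m n} → T (R m n) → T (R n m) → m ≡ n
  antisym′ (inj₁ (_ , _ , lo)) = antisym lo
  antisym′ (inj₂ lo)           = antisym lo

  total′ : IsFin R ⊎ IsLO R →
           ∀ {m n} → T (R m m) → T (R n n) → T (R m n) ⊎ T (R n m)
  total′ (inj₁ (_ , _ , lo)) p q =
    total lo (proj₁ (support lo p)) (proj₁ (support lo q))
  total′ (inj₂ lo) p q =
    total lo (proj₁ (support lo p)) (proj₁ (support lo q))

order : Lin → LinearOrder
order L = DecTotalOrder.totalOrder (decOrder L)

Elem : Lin → Set
Elem L = Carrier (order L)

Scat : Pred Lin 0ℓ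
Scat L = ¬ (DecTotalOrder.totalOrder ℚ.≤-decTotalOrder ≼ order L)

infix 4 _∈≅_

-- Membership up to isomorphism, for orders that are not literally codes.

_∈≅_ : LinearOrder → Pred Lin ℓ → Set ℓ
X ∈≅ ℒ = ∃[ M ] M ∈ ℒ × order M ≅ X

DownwardClosed : Pred Lin ℓ → Set ℓ
DownwardClosed ℒ = ∀ {K L} → order K ≼ order L → L ∈ ℒ → K ∈ ℒ

-- Pairs (x , k) in antilexicographic order: the second coordinate is compared
-- first, hence the swap.

SumCarrier : (K K′ : Lin) → (Elem K → Pred (Elem K′) 0ℓ) → Set
SumCarrier K K′ F = Σ[ (x , k) ∈ Elem K′ × Elem K ] x ∈ F k

convexSum : (K K′ : Lin) → (Elem K → Pred (Elem K′) 0ℓ) → LinearOrder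
convexSum K K′ F = On.totalOrder (×-totalOrder (decOrder K) (order K′)) pair
  where
  pair : SumCarrier K K′ F → Elem K × Elem K′
  pair = swap ∘ proj₁

ClosedUnderConvexSums : Pred Lin ℓ → Set (lsuc 0ℓ ⊔ ℓ)
ClosedUnderConvexSums ℒ =
  ∀ (K K′ : Lin) → K ∈ ℒ → K′ ∈ ℒ →
  (F : Elem K → Pred (Elem K′) 0ℓ) →
  (∀ k → Satisfiable (F k)) →
  (∀ k → IsConvex (order K′) (F k)) →
  (∀ k₀ k₁ → Strictly (order K) k₀ k₁ → AllBelow (order K′) (F k₀) (F k₁)) →
  convexSum K K′ F ∈≅ ℒ

infix 4 _⊴[_]_ _⊴LO[_]_

_⊴[_]_ : Lin → Pred Lin ℓ → Lin → Set (lsuc 0ℓ ⊔ ℓ)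
L ⊴[ ℒ ] L′ =
  Σ[ K ∈ Lin ] K ∈ ℒ ×
  Σ[ P ∈ (Elem K → Pred (Elem L) 0ℓ) ] IsConvexPartition (order K) (order L) P ×
  Σ[ f ∈ (Elem L → Elem L′) ] IsEmbedding (order L) (order L′) f ×
    (∀ k → IsConvex (order L′) (Image (order L) (order L′) f (P k)))

_⊴LO[_]_ : LO → Pred Lin ℓ → LO → Set (lsuc 0ℓ ⊔ ℓ)
L ⊴LO[ ℒ ] L′ = LO⇒Lin L ⊴[ ℒ ] LO⇒Lin L′

-- Dedekind cuts, given by their lower sets.

record ℝ : Set₁ where
  field
    cut       : Pred ℚ 0ℓ
    nonempty  : ∃[ q ] q ∈ cut
    proper    : ∃[ q ] ¬ (q ∈ cut)
    lower     : ∀ {p q} → p ≤ℚ q → q ∈ cut → p ∈ cut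
    noMaximum : ∀ {p} → p ∈ cut → ∃[ q ] p <ℚ q × q ∈ cut

infix 4 _≤ℝ_

_≤ℝ_ : ℝ → ℝ → Set
x ≤ℝ y = ℝ.cut x ⊆ ℝ.cut y

ℝ-setoid : Setoid (lsuc 0ℓ) 0ℓ
ℝ-setoid = record
  { Carrier = ℝ
  ; _≈_ = λ x y → x ≤ℝ y × y ≤ℝ x
  ; isEquivalence = record
    { refl = (λ p → p) , (λ p → p)
    ; sym = swap
    ; trans = λ (p , p′) (q , q′) → (λ r → q (p r)) , (λ r → p′ (q′ r))
    }
  }

-- Equality of elements of 2^(ℕ×ℕ) is pointwise, so that no function
-- extensionality is involved.

LO-setoid : Setoid 0ℓ 0ℓ
LO-setoid = record
  { Carrier = LO
  ; _≈_ = λ (R , _) (S , _) → ∀ m n → R m n ≡ S m n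
  ; isEquivalence = record
    { refl = λ m n → refl
    ; sym = λ p m n → sym (p m n)
    ; trans = λ p q m n → trans (p m n) (q m n)
    }
  }

-- A function ℝ → LO has to be well defined on equivalent cuts, whence Func.

RealChain : Pred Lin ℓ → Set (lsuc 0ℓ ⊔ ℓ)
RealChain ℒ = Σ[ L ∈ Func ℝ-setoid LO-setoid ]
  (∀ x y → (Func.to L x ⊴LO[ ℒ ] Func.to L y) ⇔ (x ≤ℝ y))

IsAntichain : Pred Lin ℓ → Pred LO 0ℓ → Set (lsuc 0ℓ ⊔ ℓ)
IsAntichain ℒ A = ∀ {L L′} → L ∈ A → L′ ∈ A →
  ¬ (Setoid._≈_ LO-setoid L L′) →
  ¬ (L ⊴LO[ ℒ ] L′) × ¬ (L′ ⊴LO[ ℒ ] L)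

HasSizeContinuum : Pred LO 0ℓ → Set
HasSizeContinuum A =
  Bijection (ℕ →-setoid Bool) (On.setoid LO-setoid underlying)
  where
  underlying : Σ LO A → LO
  underlying = proj₁

ContinuumAntichain : Pred Lin ℓ → Set (lsuc 0ℓ ⊔ ℓ)
ContinuumAntichain ℒ = Σ[ A ∈ Pred LO 0ℓ ] IsAntichain ℒ A × HasSizeContinuum A

{-# OPTIONS --safe #-}
module Submission where

-- For a nonempty set A of rationals, let L_A be the sum, over q ∈ A in
-- increasing order, of ℚ many consecutive copies of a finite chain with
-- codeℚ q + 1 elements, where codeℚ : ℚ → ℕ is injective.  Equivalently, L_A
-- consists of the points ((q , p) , i) with q ∈ A, p ∈ ℚ and i ≤ codeℚ q,
-- ordered lexicographically.  Two facts carry the theorem.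
--
-- (1) If L_A ⊴ L_B then A ⊆ B (⊴⇒⊆).  The index order K of the witnessing
-- partition is scattered, so for q ∈ A the points ((q , p) , 0), p ∈ ℚ, cannot
-- all lie in different pieces: otherwise ℚ would embed into K (shared-piece).
-- Hence one piece contains every point between some ((q , p₀) , 0) and
-- ((q , p₁) , 0) with p₀ < p₁, and in particular a whole chain
-- ((q , p) , 0), ..., ((q , p) , codeℚ q) with p₀ < p < p₁.  An embedding
-- with convex image preserves immediate successors, and the image contains the
-- immediate predecessor (successor) of each of its points, if there is one and
-- the point is not the least (greatest) of the image.  Since B × ℚ is densely
-- ordered, whatever B is, the immediate successor of ((r , s) , i) in L_B can
-- only be ((r , s) , i + 1).  The chain is therefore mapped onto a
-- full chain of L_B; comparing lengths gives codeℚ q = codeℚ r with r ∈ B, so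
-- q = r ∈ B (block-preserved).
--
-- (2) If A is an initial segment of B then L_A is isomorphic to an initial
-- segment of L_B, so L_A ⊴ L_B with a single piece (initial⇒⊴).  Nonemptiness
-- and downward closure put the one-point order in ℒ (singleton∈).
--
-- For Dedekind cuts A and B, (1) and (2) say that L_A ⊴ L_B iff A ⊆ B: this
-- is the chain.  For s : ℕ → Bool let A_s contain n if s n is true, and
-- - (n + 1) otherwise; then A_s ⊆ A_t forces s = t, so the L_{A_s} form an
-- antichain by (1).
--
-- To obtain orders with domain ℕ, the points of L_A are enumerated by increasing
-- code.  The n-th point is characterised by having exactly n points of L_A with
-- a smaller code, so the resulting element of 2^(ℕ×ℕ) depends on the set A only.

open import Axiom.ExcludedMiddle using (ExcludedMiddle)
open import Data.Product using (_×_)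
open import Level using (Level)
open import Relation.Unary using (Pred; _⊆_; Satisfiable)
open import Defs

open import Data.Bool using (Bool; true; false; T; if_then_else_)
open import Data.Integer using (ℤ; +_; -[1+_])
open import Data.List using ([]; _∷_; [_])
open import Data.List.Membership.Propositional using () renaming (_∈_ to _∈ˡ_)
open import Data.List.Relation.Unary.Any using (here)
open import Data.Nat using (ℕ; zero; suc; _+_; _*_; _≤_; _<_; z≤n; s≤s; _≤?_;
  _≤′_; ≤′-refl; ≤′-step)
import Data.Nat.Properties as ℕ
open import Data.Product using (∃-syntax; _,_; proj₁; proj₂)
open import Data.Product.Relation.Binary.Lex.Strict
  using (×-Lex; ×-isStrictTotalOrder; ×-transitive; ×-antisymmetric; ×-total₂; ×-decidable)
open import Data.Product.Relation.Binary.Pointwise.NonDependent using (Pointwise)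
open import Data.Rational using (ℚ; mkℚ; 0ℚ; 1ℚ)
  renaming (_≤_ to _≤ℚ_; _<_ to _<ℚ_; _+_ to _+ℚ_)
open import Data.Rational.Literals using (fromℤ)
import Data.Rational.Properties as ℚ
open import Data.Sum using (_⊎_; inj₁; inj₂; [_,_]′) renaming (map to ⊎-map)
open import Data.Unit using (⊤; tt)
open import Function using (_∘_; id; mk⇔; Equivalence)
open import Level using (0ℓ)
open import Relation.Binary.Morphism.Structures using (IsOrderMonomorphism)
open import Relation.Binary
  using (TotalOrder; DecTotalOrder; IsStrictTotalOrder; tri<; tri≈; tri>; Setoid)
open import Relation.Binary.PropositionalEquality
  using (_≡_; _≗_; refl; sym; trans; cong; cong₂; subst; subst₂; module ≡-Reasoning)
open import Relation.Nullary using (Dec; yes; no; ¬_; does; contradiction)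
open import Relation.Nullary.Decidable
  using (⌊_⌋; toWitness; fromWitness; does-⇔; dec-true)
open import Relation.Unary using (_∈_)

open TotalOrder using (Carrier)

-- Injective codes for pairs, integers and rationals

-- (m , n) ↦ 2 ^ m * (2 * n + 1), an injection ℕ × ℕ → ℕ.

pair : ℕ → ℕ → ℕ
pair zero    n = suc (2 * n)
pair (suc m) n = 2 * pair m n

pair-injective : ∀ m n m′ n′ → pair m n ≡ pair m′ n′ → m ≡ m′ × n ≡ n′
pair-injective zero    n zero     n′ eq = refl , ℕ.*-cancelˡ-≡ _ _ 2 (ℕ.suc-injective eq)
pair-injective zero    n (suc m′) n′ eq = contradiction (sym eq) (ℕ.even≢odd (pair m′ n′) n)
pair-injective (suc m) n zero     n′ eq = contradiction eq (ℕ.even≢odd (pair m n) n′)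
pair-injective (suc m) n (suc m′) n′ eq
  with refl , n≡n′ ← pair-injective m n m′ n′ (ℕ.*-cancelˡ-≡ _ _ 2 eq) = refl , n≡n′

n≤pair : ∀ m n → n ≤ pair m n
n≤pair zero    n = ℕ.m≤n⇒m≤1+n (ℕ.m≤m+n n _)
n≤pair (suc m) n = ℕ.≤-trans (n≤pair m n) (ℕ.m≤m+n _ _)

codeℤ : ℤ → ℕ
codeℤ (+ n)    = pair 0 n
codeℤ -[1+ n ] = pair 1 n

codeℤ-injective : ∀ {y z} → codeℤ y ≡ codeℤ z → y ≡ z
codeℤ-injective {+ m}       {+ n}       eq = cong +_ (proj₂ (pair-injective 0 m 0 n eq))
codeℤ-injective {+ m}       { -[1+ n ]} eq with () ← proj₁ (pair-injective 0 m 1 n eq)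
codeℤ-injective { -[1+ m ]} {+ n}       eq with () ← proj₁ (pair-injective 1 m 0 n eq)
codeℤ-injective { -[1+ m ]} { -[1+ n ]} eq = cong -[1+_] (proj₂ (pair-injective 1 m 1 n eq))

codeℚ : ℚ → ℕ
codeℚ (mkℚ z d _) = pair d (codeℤ z)

codeℚ-injective : ∀ {p q} → codeℚ p ≡ codeℚ q → p ≡ q
codeℚ-injective {mkℚ y d _} {mkℚ z e _} eq
  with refl , eq′ ← pair-injective d (codeℤ y) e (codeℤ z) eq
  with refl ← codeℤ-injective {y} {z} eq′ = refl

-- Points and their lexicographic order

-- The chains making up L_A are indexed by pairs (q , p): the chain has
-- codeℚ q + 1 elements, and p runs through its ℚ many copies.

Index : Set
Index = ℚ × ℚ

-- ((q , p) , i) is the i-th element, counted from 0, of the chain (q , p).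

Point : Set
Point = Index × ℕ

codeᴾ : Point → ℕ
codeᴾ ((q , p) , i) = pair i (pair (codeℚ q) (codeℚ p))

codeᴾ-injective : ∀ {a b} → codeᴾ a ≡ codeᴾ b → a ≡ b
codeᴾ-injective {(q , p) , i} {(r , s) , j} eq
  with refl , eq₁ ← pair-injective i (pair (codeℚ q) (codeℚ p)) j (pair (codeℚ r) (codeℚ s)) eq
  with eq₂ , eq₃ ← pair-injective (codeℚ q) (codeℚ p) (codeℚ r) (codeℚ s) eq₁
  with refl ← codeℚ-injective {q} {r} eq₂ | refl ← codeℚ-injective {p} {s} eq₃ = refl

infix 4 _<ᴵ_ _≤ᴾ_ _≤ᴾ?_

_<ᴵ_ : Index → Index → Set
_<ᴵ_ = ×-Lex _≡_ _<ℚ_ _<ℚ_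

<ᴵ-isStrictTotalOrder : IsStrictTotalOrder (Pointwise _≡_ _≡_) _<ᴵ_
<ᴵ-isStrictTotalOrder =
  ×-isStrictTotalOrder ℚ.<-isStrictTotalOrder ℚ.<-isStrictTotalOrder

private
  module I = IsStrictTotalOrder <ᴵ-isStrictTotalOrder

_≤ᴾ_ : Point → Point → Set
_≤ᴾ_ = ×-Lex (Pointwise _≡_ _≡_) _<ᴵ_ _≤_

≤ᴾ-refl : ∀ {a} → a ≤ᴾ a
≤ᴾ-refl = inj₂ ((refl , refl) , ℕ.≤-refl)

≤ᴾ-reflexive : ∀ {a b} → a ≡ b → a ≤ᴾ b
≤ᴾ-reflexive refl = ≤ᴾ-refl

≤ᴾ-trans : ∀ {a b c} → a ≤ᴾ b → b ≤ᴾ c → a ≤ᴾ c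
≤ᴾ-trans {a} {b} {c} =
  ×-transitive {_<₂_ = _≤_} I.isEquivalence I.<-resp-≈ I.trans ℕ.≤-trans {a} {b} {c}

≤ᴾ-antisym : ∀ {a b} → a ≤ᴾ b → b ≤ᴾ a → a ≡ b
≤ᴾ-antisym {a} {b} a≤b b≤a
  with (refl , refl) , refl ←
    ×-antisymmetric {_<₁_ = _<ᴵ_} {_<₂_ = _≤_} I.Eq.sym I.irrefl I.asym ℕ.≤-antisym
      {a} {b} a≤b b≤a = refl

≤ᴾ-total : ∀ a b → a ≤ᴾ b ⊎ b ≤ᴾ a
≤ᴾ-total = ×-total₂ I.Eq.sym I.compare ℕ.≤-total

_≤ᴾ?_ : ∀ a b → Dec (a ≤ᴾ b)
_≤ᴾ?_ = ×-decidable I._≟_ I._<?_ _≤?_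

<ᴵ⇒≱ᴾ : ∀ {j k i i′} → j <ᴵ k → ¬ ((k , i) ≤ᴾ (j , i′))
<ᴵ⇒≱ᴾ {j} {k} j<k (inj₁ k<j)       = I.asym {j} {k} j<k k<j
<ᴵ⇒≱ᴾ {j} {k} j<k (inj₂ (k≈j , _)) = I.irrefl {j} {k} (I.Eq.sym {k} {j} k≈j) j<k

-- The interpolated index keeps the first coordinate of the lower index, so
-- A × ℚ is dense in itself for every set A of rationals.

<ᴵ-dense : ∀ {j k} → j <ᴵ k → ∃[ l ] proj₁ l ≡ proj₁ j × j <ᴵ l × l <ᴵ k
<ᴵ-dense {q , p} (inj₁ q<r) =
  (q , p +ℚ 1ℚ) , refl , inj₂ (refl , p<p+1) , inj₁ q<r
  where
  p<p+1 : p <ℚ p +ℚ 1ℚ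
  p<p+1 = subst (_<ℚ p +ℚ 1ℚ) (ℚ.+-identityʳ p) (ℚ.+-monoʳ-< p (toWitness {a? = 0ℚ ℚ.<? 1ℚ} tt))
<ᴵ-dense {q , p} (inj₂ (q≡r , p<s)) with ℚ.<-dense p<s
... | m , p<m , m<s = (q , m) , refl , inj₂ (refl , p<m) , inj₂ (q≡r , m<s)

-- The orders L_A and their immediate successors

-- The set of points of L_A.

Blocks : Pred ℚ 0ℓ → Pred Point 0ℓ
Blocks A ((q , p) , i) = q ∈ A × i ≤ codeℚ q

up : Point → Point
up (j , i) = j , suc i

module _ {A : Pred ℚ 0ℓ} where

  -- An immediate successor in L_A can only be the next element of the same
  -- chain: between different chains there is always a third one.

  next-point : ∀ {a b} → a ∈ Blocks A → b ∈ Blocks A → ¬ (b ≤ᴾ a) →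
               (∀ {c} → c ∈ Blocks A → c ≤ᴾ a ⊎ b ≤ᴾ c) → b ≡ up a
  next-point {j , i} {k , i′} (q∈A , _) (_ , i′≤) b≰a between with I.compare j k
  ... | tri> _ _ k<j = contradiction (inj₁ k<j) b≰a
  ... | tri< j<k _ _ with l , refl , j<l , l<k ← <ᴵ-dense j<k =
    contradiction (between {l , 0} (q∈A , z≤n)) [ <ᴵ⇒≱ᴾ j<l , <ᴵ⇒≱ᴾ l<k ]′
  ... | tri≈ _ j≈k@(refl , refl) _ with i<i′ ← ℕ.≰⇒> (λ i′≤i → b≰a (inj₂ ((refl , refl) , i′≤i)))
    with between {j , suc i} (q∈A , ℕ.≤-trans i<i′ i′≤)
  ...   | inj₁ (inj₁ j<j) = contradiction j<j (I.irrefl {j} {j} j≈k)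
  ...   | inj₁ (inj₂ (_ , i<i)) = contradiction i<i ℕ.1+n≰n
  ...   | inj₂ (inj₁ j<j) = contradiction j<j (I.irrefl {j} {j} j≈k)
  ...   | inj₂ (inj₂ (_ , i′≤1+i)) = cong (j ,_) (ℕ.≤-antisym i′≤1+i i<i′)

up-≰ : ∀ {a} → ¬ (up a ≤ᴾ a)
up-≰ {j , i} (inj₁ j<j) = I.irrefl {j} {j} (refl , refl) j<j
up-≰ (inj₂ (_ , i<i)) = ℕ.1+n≰n i<i

up-next : ∀ a b → b ≤ᴾ a ⊎ up a ≤ᴾ b
up-next (j , i) (k , i′) with I.compare j k
... | tri< j<k _ _ = inj₂ (inj₁ j<k)
... | tri> _ _ k<j = inj₁ (inj₁ k<j)
... | tri≈ _ (refl , refl) _ with ℕ.≤-<-connex i′ i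
...   | inj₁ i′≤i = inj₁ (inj₂ ((refl , refl) , i′≤i))
...   | inj₂ i<i′ = inj₂ (inj₂ ((refl , refl) , i<i′))

-- y is the immediate successor of x in Y; the second component states
-- positively that nothing lies strictly between x and y.

IsCover : (Y : LinearOrder) → Carrier Y → Carrier Y → Set
IsCover Y x y = ¬ (y ≤ʸ x) × (∀ z → z ≤ʸ x ⊎ y ≤ʸ z)
  where open TotalOrder Y renaming (_≤_ to _≤ʸ_)

-- Y is isomorphic to L_A: label is an order isomorphism from Y onto the points
-- of L_A.

record Realises (A : Pred ℚ 0ℓ) (Y : LinearOrder) : Set where
  open TotalOrder Y using () renaming (_≤_ to _≤ʸ_)
  field
    label        : Carrier Y → Point
    label-mono   : ∀ {x y} → x ≤ʸ y → label x ≤ᴾ label y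
    label-cancel : ∀ {x y} → label x ≤ᴾ label y → x ≤ʸ y
    label-∈      : ∀ x → label x ∈ Blocks A
    label-onto   : ∀ a → a ∈ Blocks A → ∃[ x ] label x ≡ a

  cover⇒up : ∀ {x y} → IsCover Y x y → label y ≡ up (label x)
  cover⇒up {x} {y} (y≰x , between) =
    next-point (label-∈ x) (label-∈ y) (y≰x ∘ label-cancel) between′
    where
    between′ : ∀ {c} → c ∈ Blocks A → c ≤ᴾ label x ⊎ label y ≤ᴾ c
    between′ {c} c∈ with z , refl ← label-onto c c∈ = ⊎-map label-mono label-mono (between z)

  up⇒cover : ∀ {x y} → label y ≡ up (label x) → IsCover Y x y
  up⇒cover {x} {y} eq =
    (λ y≤x → up-≰ (subst (_≤ᴾ label x) eq (label-mono y≤x))) ,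
    (λ z → ⊎-map label-cancel (λ h → label-cancel (subst (_≤ᴾ label z) (sym eq) h))
             (up-next (label x) (label z)))

-- Embeddings with convex image

module _ (Y Y′ : LinearOrder) {f : Carrier Y → Carrier Y′} (f-emb : IsEmbedding Y Y′ f)
         {S : Pred (Carrier Y) 0ℓ} (fS-convex : IsConvex Y′ (Image Y Y′ f S)) where
  private
    module Y = TotalOrder Y
    module Y′ = TotalOrder Y′
  open IsOrderMonomorphism f-emb using (mono; cancel)

  cover-preserved : ∀ {u v} → u ∈ S → v ∈ S → IsCover Y u v → IsCover Y′ (f u) (f v)
  cover-preserved {u} {v} u∈S v∈S (v≰u , between) = v≰u ∘ cancel , between′
    where
    between′ : ∀ z → z Y′.≤ f u ⊎ f v Y′.≤ z
    between′ z with Y′.total z (f u) | Y′.total (f v) z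
    ... | inj₁ z≤fu | _         = inj₁ z≤fu
    ... | inj₂ _    | inj₁ fv≤z = inj₂ fv≤z
    ... | inj₂ fu≤z | inj₂ z≤fv
      with w , _ , fw≈z ← fS-convex fu≤z z≤fv (u , u∈S , Y′.Eq.refl) (v , v∈S , Y′.Eq.refl)
      with between w
    ...   | inj₁ w≤u = inj₁ (Y′.trans (Y′.reflexive (Y′.Eq.sym fw≈z)) (mono w≤u))
    ...   | inj₂ v≤w = inj₂ (Y′.trans (mono v≤w) (Y′.reflexive fw≈z))

  private
    cover-reflected : ∀ {u v} → IsCover Y′ (f u) (f v) → IsCover Y u v
    cover-reflected (fv≰fu , between) =
      fv≰fu ∘ mono , λ z → ⊎-map cancel cancel (between (f z))

  -- An immediate predecessor of f v lies in the image of S if f v is not the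
  -- least point of that image, and it is then the image of one of v.

  cover-below : ∀ {u v c} → u ∈ S → v ∈ S → ¬ (v Y.≤ u) → IsCover Y′ c (f v) →
                ∃[ w ] IsCover Y w v
  cover-below {u} {v} {c} u∈S v∈S v≰u (fv≰c , between)
    = let w , _ , fw≈c = fS-convex fu≤c c≤fv (u , u∈S , Y′.Eq.refl) (v , v∈S , Y′.Eq.refl)
      in w , cover-reflected
            ( (λ fv≤fw → fv≰c (Y′.trans fv≤fw (Y′.reflexive fw≈c)))
            , λ z → ⊎-map (λ z≤c → Y′.trans z≤c (Y′.reflexive (Y′.Eq.sym fw≈c))) id (between z))
    where
    fu≤c : f u Y′.≤ c
    fu≤c = [ id , (λ fv≤fu → contradiction (cancel fv≤fu) v≰u) ]′ (between (f u))
    c≤fv : c Y′.≤ f v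
    c≤fv = [ id , (λ fv≤c → contradiction fv≤c fv≰c) ]′ (Y′.total c (f v))

  cover-above : ∀ {u v c} → u ∈ S → v ∈ S → ¬ (v Y.≤ u) → IsCover Y′ (f u) c →
                ∃[ w ] IsCover Y u w
  cover-above {u} {v} {c} u∈S v∈S v≰u (c≰fu , between)
    = let w , _ , fw≈c = fS-convex fu≤c c≤fv (u , u∈S , Y′.Eq.refl) (v , v∈S , Y′.Eq.refl)
      in w , cover-reflected
            ( (λ fw≤fu → c≰fu (Y′.trans (Y′.reflexive (Y′.Eq.sym fw≈c)) fw≤fu))
            , λ z → ⊎-map id (Y′.trans (Y′.reflexive fw≈c)) (between z))
    where
    fu≤c : f u Y′.≤ c
    fu≤c = [ id , (λ c≤fu → contradiction c≤fu c≰fu) ]′ (Y′.total (f u) c)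
    c≤fv : c Y′.≤ f v
    c≤fv = [ (λ fv≤fu → contradiction (cancel fv≤fu) v≰u) , id ]′ (between (f v))

raise : ℕ → Point → Point
raise i (j , c) = j , i + c

module _ {A B : Pred ℚ 0ℓ} {Y Y′ : LinearOrder} (rY : Realises A Y) (rY′ : Realises B Y′)
         {f : Carrier Y → Carrier Y′} (f-emb : IsEmbedding Y Y′ f)
         {S : Pred (Carrier Y) 0ℓ} (S-convex : IsConvex Y S)
         (fS-convex : IsConvex Y′ (Image Y Y′ f S)) where
  private
    module Y = TotalOrder Y
    module R = Realises rY
    module R′ = Realises rY′

  -- If S contains the first elements u and v of two different chains with first
  -- index q, then f maps any chain strictly between them onto a full chain of
  -- L_B.  Chain lengths determine the first index, so q ∈ B.

  block-preserved : ∀ {q p₀ p₁ u v} → p₀ <ℚ p₁ → u ∈ S → v ∈ S →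
    R.label u ≡ ((q , p₀) , 0) → R.label v ≡ ((q , p₁) , 0) → q ∈ B
  block-preserved {q} {p₀} {p₁} {u} {v} p₀<p₁ u∈S v∈S lu lv = q∈B
    where
    p : ℚ
    p = proj₁ (ℚ.<-dense p₀<p₁)

    j : Index
    j = q , p

    u<j : (q , p₀) <ᴵ j
    u<j = inj₂ (refl , proj₁ (proj₂ (ℚ.<-dense p₀<p₁)))

    j<v : j <ᴵ (q , p₁)
    j<v = inj₂ (refl , proj₂ (proj₂ (ℚ.<-dense p₀<p₁)))

    N : ℕ
    N = codeℚ q

    q∈A : q ∈ A
    q∈A = proj₁ (subst (_∈ Blocks A) lu (R.label-∈ u))

    below : ∀ {x i} → R.label x ≡ (j , i) → ¬ (x Y.≤ u)
    below lx x≤u = <ᴵ⇒≱ᴾ u<j (subst₂ _≤ᴾ_ lx lu (R.label-mono x≤u))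

    above : ∀ {x i} → R.label x ≡ (j , i) → ¬ (v Y.≤ x)
    above lx v≤x = <ᴵ⇒≱ᴾ j<v (subst₂ _≤ᴾ_ lv lx (R.label-mono v≤x))

    element : ∀ {i} → i ≤ N → ∃[ x ] x ∈ S × R.label x ≡ (j , i)
    element {i} i≤N with x , lx ← R.label-onto (j , i) (q∈A , i≤N) = x , S-convex u≤x x≤v u∈S v∈S , lx
      where
      u≤x : u Y.≤ x
      u≤x = R.label-cancel (subst₂ _≤ᴾ_ (sym lu) (sym lx) (inj₁ u<j))
      x≤v : x Y.≤ v
      x≤v = R.label-cancel (subst₂ _≤ᴾ_ (sym lx) (sym lv) (inj₁ j<v))

    bottom : ∃[ x ] x ∈ S × R.label x ≡ (j , 0)
    bottom = element z≤n

    x₀ = proj₁ bottom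
    a₀ = R′.label (f x₀)

    q′ : ℚ
    q′ = proj₁ (proj₁ a₀)

    -- The chain j is mapped to consecutive elements of one chain.
    image-label : ∀ i → i ≤ N →
      ∃[ x ] x ∈ S × R.label x ≡ (j , i) × R′.label (f x) ≡ raise i a₀
    image-label zero _ = x₀ , proj₁ (proj₂ bottom) , proj₂ (proj₂ bottom) , refl
    image-label (suc i) i<N
      with x , x∈S , lx , lfx ← image-label i (ℕ.<⇒≤ i<N)
      with y , y∈S , ly ← element i<N =
      y , y∈S , ly ,
      trans (R′.cover⇒up (cover-preserved Y Y′ f-emb fS-convex x∈S y∈S x⋖y)) (cong up lfx)
      where
      x⋖y : IsCover Y x y
      x⋖y = R.up⇒cover (trans ly (cong up (sym lx)))

    -- Otherwise f x₀ would have an immediate predecessor, hence x₀ as well.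
    starts-at-0 : proj₂ a₀ ≡ 0
    starts-at-0 with proj₂ a₀ in eq
    ... | zero = refl
    ... | suc d
      with q′∈B , a₀≤ ← R′.label-∈ (f x₀)
      with c , lc ← R′.label-onto (proj₁ a₀ , d)
             (q′∈B , ℕ.≤-trans (ℕ.n≤1+n d) (subst (_≤ codeℚ q′) eq a₀≤))
      with w , w⋖x₀ ← cover-below Y Y′ f-emb fS-convex u∈S (proj₁ (proj₂ bottom))
             (below (proj₂ (proj₂ bottom)))
             (R′.up⇒cover (trans (cong (proj₁ a₀ ,_) eq) (cong up (sym lc))))
      with () ← trans (sym (cong proj₂ (proj₂ (proj₂ bottom)))) (cong proj₂ (R.cover⇒up w⋖x₀))

    top : ∃[ x ] x ∈ S × R.label x ≡ (j , N) × R′.label (f x) ≡ raise N a₀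
    top = image-label N ℕ.≤-refl

    fits : N + proj₂ a₀ ≤ codeℚ q′
    fits with x , _ , _ , lfx ← top = proj₂ (subst (_∈ Blocks B) lfx (R′.label-∈ (f x)))

    -- Otherwise the image of the last element of the chain j would have an
    -- immediate successor, hence that element as well.
    ends-at-top : ¬ (N + proj₂ a₀ < codeℚ q′)
    ends-at-top <q′
      with x , x∈S , lx , lfx ← top
      with c , lc ← R′.label-onto (proj₁ a₀ , suc (N + proj₂ a₀))
             (proj₁ (R′.label-∈ (f x₀)) , <q′)
      with w , x⋖w ← cover-above Y Y′ f-emb fS-convex x∈S v∈S (above lx)
             (R′.up⇒cover (trans lc (cong up (sym lfx))))
      = ℕ.1+n≰n (proj₂ (subst (_∈ Blocks A) (trans (R.cover⇒up x⋖w) (cong up lx)) (R.label-∈ w)))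

    size≡ : N ≡ codeℚ q′
    size≡ = begin
      N              ≡⟨ ℕ.+-identityʳ N ⟨
      N + 0          ≡⟨ cong (λ c → N + c) starts-at-0 ⟨
      N + proj₂ a₀   ≡⟨ ℕ.≤-antisym fits (ℕ.≮⇒≥ ends-at-top) ⟩
      codeℚ q′       ∎
      where open ≡-Reasoning

    q∈B : q ∈ B
    q∈B = subst (_∈ B) (sym (codeℚ-injective {q} {q′} size≡)) (proj₁ (R′.label-∈ (f x₀)))

-- Partitions over a scattered order

ℚ-order : LinearOrder
ℚ-order = DecTotalOrder.totalOrder ℚ.≤-decTotalOrder

module _ (em : ExcludedMiddle 0ℓ) (K Y : LinearOrder) {P : Carrier K → Pred (Carrier Y) 0ℓ}
         (partition : IsConvexPartition K Y P) where
  private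
    module K = TotalOrder K
    module Y = TotalOrder Y
    module P = IsConvexPartition partition

    pieces-ordered : ∀ {k k′ x y} → k K.≤ k′ → ¬ (k K.≈ k′) → x ∈ P k → y ∈ P k′ → Strictly Y x y
    pieces-ordered k≤k′ k≉k′ = Equivalence.to (P.ordered _ _) (k≤k′ , k≉k′)

  pieces-convex : ∀ k → IsConvex Y (P k)
  pieces-convex k {x} {y} {z} x≤y y≤z x∈P z∈P with P.covers y
  ... | k′ , y∈P with em {P = k K.≈ k′}
  ...   | yes k≈k′ = P.respectsIndex (K.Eq.sym k≈k′) y∈P
  ...   | no  k≉k′ with K.total k k′
  ...     | inj₁ k≤k′ with z≤y , z≉y ← pieces-ordered k≤k′ k≉k′ z∈P y∈P =
    contradiction (Y.antisym z≤y y≤z) z≉y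
  ...     | inj₂ k′≤k with y≤x , y≉x ← pieces-ordered k′≤k (k≉k′ ∘ K.Eq.sym) y∈P x∈P =
    contradiction (Y.antisym y≤x x≤y) y≉x

  -- A strictly increasing family indexed by ℚ meets some piece twice: otherwise
  -- sending p to the piece of t p would embed ℚ into K.

  shared-piece : ¬ (ℚ-order ≼ K) → (t : ℚ → Carrier Y) →
    (∀ {p p′} → p <ℚ p′ → ¬ (t p′ Y.≤ t p)) →
    ∃[ k ] ∃[ p ] ∃[ p′ ] p <ℚ p′ × t p ∈ P k × t p′ ∈ P k
  shared-piece scattered t t-mono
    with em {P = ∃[ p ] ∃[ p′ ] p <ℚ p′ × proj₁ (P.covers (t p)) K.≈ proj₁ (P.covers (t p′))}
  ... | yes (p , p′ , p<p′ , eq) =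
    _ , p , p′ , p<p′ , P.respectsIndex eq (proj₂ (P.covers (t p))) , proj₂ (P.covers (t p′))
  ... | no none = contradiction (piece , piece-emb) scattered
    where
    piece : ℚ → Carrier K
    piece p = proj₁ (P.covers (t p))

    piece-mono-< : ∀ {p p′} → p <ℚ p′ → piece p K.≤ piece p′
    piece-mono-< {p} {p′} p<p′ with K.total (piece p) (piece p′)
    ... | inj₁ le = le
    ... | inj₂ ge = contradiction
      (proj₁ (pieces-ordered ge (λ eq → none (p , p′ , p<p′ , K.Eq.sym eq))
        (proj₂ (P.covers (t p′))) (proj₂ (P.covers (t p)))))
      (t-mono p<p′)

    piece-mono : ∀ {p p′} → p ≤ℚ p′ → piece p K.≤ piece p′
    piece-mono {p} {p′} p≤p′ with ℚ.<-cmp p p′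
    ... | tri< p<p′ _ _ = piece-mono-< p<p′
    ... | tri≈ _ refl _ = K.refl
    ... | tri> _ _ p′<p = contradiction (ℚ.<-≤-trans p′<p p≤p′) (ℚ.<-irrefl refl)

    piece-cancel : ∀ {p p′} → piece p K.≤ piece p′ → p ≤ℚ p′
    piece-cancel {p} {p′} le with p ℚ.≤? p′
    ... | yes p≤p′ = p≤p′
    ... | no  p≰p′ with p′<p ← ℚ.≰⇒> p≰p′ =
      contradiction (p′ , p , p′<p , K.antisym (piece-mono-< p′<p) le) none

    piece-emb : IsEmbedding ℚ-order K piece
    piece-emb = record
      { isOrderHomomorphism = record { cong = λ { refl → K.Eq.refl } ; mono = piece-mono }
      ; injective = λ eq → ℚ.≤-antisym (piece-cancel (K.reflexive eq))
                                       (piece-cancel (K.reflexive (K.Eq.sym eq)))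
      ; cancel = piece-cancel
      }

module _ {A : Pred ℚ 0ℓ} {Y : LinearOrder} (rY : Realises A Y) {q : ℚ} (q∈A : q ∈ A) where
  open Realises rY

  -- The element of Y labelled by the first element of the chain (q , p).

  start : ℚ → Carrier Y
  start p = proj₁ (label-onto ((q , p) , 0) (q∈A , z≤n))

  start-label : ∀ p → label (start p) ≡ ((q , p) , 0)
  start-label p = proj₂ (label-onto ((q , p) , 0) (q∈A , z≤n))

  start-increasing : ∀ {p p′} → p <ℚ p′ → ¬ (TotalOrder._≤_ Y (start p′) (start p))
  start-increasing {p} {p′} p<p′ le = <ᴵ⇒≱ᴾ {q , p} {q , p′} (inj₂ (refl , p<p′))
    (subst₂ _≤ᴾ_ (start-label p′) (start-label p) (label-mono le))

⊴⇒⊆ : ExcludedMiddle 0ℓ → ∀ {ℓ} {ℒ : Pred Lin ℓ} → ℒ ⊆ Scat → ∀ {A B} (L L′ : Lin) →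
       Realises A (order L) → Realises B (order L′) → L ⊴[ ℒ ] L′ → A ⊆ B
⊴⇒⊆ em ℒ⊆Scat L L′ rL rL′ (K , K∈ℒ , P , partition , f , f-emb , f-convex) q∈A
  with k , p , p′ , p<p′ , u∈ , v∈ ←
       shared-piece em (order K) (order L) partition (ℒ⊆Scat {K} K∈ℒ)
         (start rL q∈A) (start-increasing rL q∈A)
  = block-preserved rL rL′ f-emb (pieces-convex em (order K) (order L) partition k) (f-convex k)
      p<p′ u∈ v∈ (start-label rL q∈A p) (start-label rL q∈A p′)

-- Initial segments

singleton : Lin
singleton = R , inj₁ ([ 0 ] , (λ ()) , isLinear)
  where
  R : Code
  R zero    zero    = true
  R zero    (suc _) = false
  R (suc _) _       = false

  isLinear : IsLinearOn (_∈ˡ [ 0 ]) R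
  isLinear = record
    { support = λ { {zero} {zero} _ → here refl , here refl }
    ; reflx   = λ { (here refl) → tt }
    ; antisym = λ { {zero} {zero} _ _ → refl }
    ; transit = λ { {zero} {zero} {zero} _ _ → tt }
    ; total   = λ { (here refl) (here refl) → inj₁ tt }
    }

singleton-unique : (x y : Elem singleton) → x ≡ y
singleton-unique (zero , tt) (zero , tt) = refl

inhabited : (L : Lin) → Elem L
inhabited (R , inj₁ ([] , nonempty , _)) = contradiction refl nonempty
inhabited (R , inj₁ (n ∷ _ , _ , lo))    = n , IsLinearOn.reflx lo (here refl)
inhabited (R , inj₂ lo)                  = 0 , IsLinearOn.reflx lo tt

singleton∈ : ∀ {ℓ} {ℒ : Pred Lin ℓ} → Satisfiable ℒ → DownwardClosed ℒ → singleton ∈ ℒ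
singleton∈ (L , L∈ℒ) closed = closed {singleton} {L} ((λ _ → inhabited L) , emb) L∈ℒ
  where
  module L = TotalOrder (order L)
  emb : IsEmbedding (order singleton) (order L) (λ _ → inhabited L)
  emb = record
    { isOrderHomomorphism = record { cong = λ _ → refl ; mono = λ _ → L.refl {inhabited L} }
    ; injective = λ {x} {y} _ → singleton-unique x y
    ; cancel = λ {x} {y} _ → TotalOrder.reflexive (order singleton) (singleton-unique x y)
    }

-- The hypotheses say that A is an initial segment of B; L is taken as one piece.

initial⇒⊴ : ∀ {ℓ} {ℒ : Pred Lin ℓ} → singleton ∈ ℒ → ∀ {A B} (L L′ : Lin) →
  Realises A (order L) → Realises B (order L′) →
  A ⊆ B → (∀ {p q} → p ≤ℚ q → p ∈ B → q ∈ A → p ∈ A) → L ⊴[ ℒ ] L′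
initial⇒⊴ singleton∈ℒ {A} {B} L L′ rL rL′ A⊆B lower =
  singleton , singleton∈ℒ , (λ _ _ → ⊤) , partition , f , f-emb , λ _ → f-convex
  where
  module L = TotalOrder (order L)
  module L′ = TotalOrder (order L′)
  module R = Realises rL
  module R′ = Realises rL′

  preimage : ∀ x → ∃[ y ] R′.label y ≡ R.label x
  preimage x = R′.label-onto (R.label x) (A⊆B (proj₁ (R.label-∈ x)) , proj₂ (R.label-∈ x))

  f : Elem L → Elem L′
  f x = proj₁ (preimage x)

  f-label : ∀ x → R′.label (f x) ≡ R.label x
  f-label x = proj₂ (preimage x)

  f-cancel : ∀ {x y} → f x L′.≤ f y → x L.≤ y
  f-cancel {x} {y} le = R.label-cancel (subst₂ _≤ᴾ_ (f-label x) (f-label y) (R′.label-mono le))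

  f-emb : IsEmbedding (order L) (order L′) f
  f-emb = record
    { isOrderHomomorphism = record
      { cong = cong f
      ; mono = λ {x} {y} le →
          R′.label-cancel (subst₂ _≤ᴾ_ (sym (f-label x)) (sym (f-label y)) (R.label-mono le))
      }
    ; injective = λ eq → L.antisym (f-cancel (L′.reflexive eq)) (f-cancel (L′.reflexive (sym eq)))
    ; cancel = f-cancel
    }

  first-≤ : ∀ {a b} → a ≤ᴾ b → proj₁ (proj₁ a) ≤ℚ proj₁ (proj₁ b)
  first-≤ (inj₁ (inj₁ q<r))          = ℚ.<⇒≤ q<r
  first-≤ (inj₁ (inj₂ (q≡r , _)))    = ℚ.≤-reflexive q≡r
  first-≤ (inj₂ ((q≡r , _) , _))     = ℚ.≤-reflexive q≡r

  f-convex : IsConvex (order L′) (Image (order L) (order L′) f (λ _ → ⊤))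
  f-convex {y = y} _ y≤fz _ (z , _ , refl)
    with q≤ ← first-≤ (subst (R′.label y ≤ᴾ_) (f-label z) (R′.label-mono y≤fz))
    with x , lx ← R.label-onto (R′.label y)
      (lower q≤ (proj₁ (R′.label-∈ y)) (proj₁ (R.label-∈ z)) , proj₂ (R′.label-∈ y))
    = x , tt , L′.antisym (R′.label-cancel (≤ᴾ-reflexive (trans (f-label x) lx)))
                          (R′.label-cancel (≤ᴾ-reflexive (sym (trans (f-label x) lx))))

  partition : IsConvexPartition (order singleton) (order L) (λ _ _ → ⊤)
  partition = record
    { respectsIndex = λ _ _ → tt
    ; respects      = λ _ _ → tt
    ; nonempty      = λ _ → inhabited L , tt
    ; covers        = λ _ → inhabited singleton , tt
    ; disjoint      = λ _ _ → singleton-unique _ _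
    ; ordered       = λ k k′ → mk⇔
        (λ k<k′ → contradiction (singleton-unique k k′) (proj₂ k<k′))
        (λ below → contradiction refl (proj₂ (below {inhabited L} {inhabited L} tt tt)))
    }

-- Enumeration of an infinite set of natural numbers

-- The number of m < n with d m ≡ true.

count : (ℕ → Bool) → ℕ → ℕ
count d zero    = 0
count d (suc n) = if d n then suc (count d n) else count d n

count-cong : ∀ {d e} → d ≗ e → ∀ n → count d n ≡ count e n
count-cong d≗e zero    = refl
count-cong d≗e (suc n) rewrite d≗e n | count-cong d≗e n = refl

module _ (d : ℕ → Bool) where

  count-hit : ∀ {n} → d n ≡ true → count d (suc n) ≡ suc (count d n)
  count-hit {n} dn rewrite dn = refl

  count-step : ∀ n → count d n ≤ count d (suc n)
  count-step n with d n
  ... | true  = ℕ.n≤1+n _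
  ... | false = ℕ.≤-refl

  count-mono : ∀ {m n} → m ≤ n → count d m ≤ count d n
  count-mono {m} {n} m≤n = go (ℕ.≤⇒≤′ m≤n)
    where
    go : ∀ {n} → m ≤′ n → count d m ≤ count d n
    go ≤′-refl       = ℕ.≤-refl
    go (≤′-step m≤n) = ℕ.≤-trans (go m≤n) (count-step _)

  count-strict : ∀ {m n} → d m ≡ true → m < n → count d m < count d n
  count-strict {m} {n} dm m<n = subst (_≤ count d n) (count-hit dm) (count-mono m<n)

  count-injective : ∀ {m n} → d m ≡ true → d n ≡ true → count d m ≡ count d n → m ≡ n
  count-injective {m} {n} dm dn eq with ℕ.<-cmp m n
  ... | tri< m<n _ _ = contradiction eq (ℕ.<⇒≢ (count-strict dm m<n))
  ... | tri≈ _ m≡n _ = m≡n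
  ... | tri> _ _ n<m = contradiction (sym eq) (ℕ.<⇒≢ (count-strict dn n<m))

  -- From b to b + 1 the count increases by at most one, and only if d b is true.

  attained : ∀ b {n} → n < count d b → ∃[ m ] d m ≡ true × count d m ≡ n
  attained (suc b) {n} n< with d b in db
  ... | false = attained b n<
  ... | true with ℕ.m≤n⇒m<n∨m≡n (ℕ.≤-pred n<)
  ...   | inj₁ n<count = attained b n<count
  ...   | inj₂ n≡count = b , db , sym n≡count

  module _ (unbounded : ∀ n → ∃[ m ] n ≤ m × d m ≡ true) where

    exceeds : ∀ n → ∃[ b ] n < count d b
    exceeds zero with m , _ , dm ← unbounded 0 =
      suc m , subst (0 <_) (sym (count-hit dm)) (s≤s z≤n)
    exceeds (suc n) with b , n< ← exceeds n
      with m , b≤m , dm ← unbounded b =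
      suc m , subst (suc n <_) (sym (count-hit dm)) (s≤s (ℕ.≤-trans n< (count-mono b≤m)))

    -- The n-th hit, counted from 0.

    nth : ∀ n → ∃[ m ] d m ≡ true × count d m ≡ n
    nth n = attained (proj₁ (exceeds n)) (proj₂ (exceeds n))

-- L_A as an order with domain ℕ

module Coding (em : ExcludedMiddle 0ℓ) where

  HasCode : Pred ℚ 0ℓ → ℕ → Set
  HasCode A n = ∃[ a ] a ∈ Blocks A × codeᴾ a ≡ n

  isCode : Pred ℚ 0ℓ → ℕ → Bool
  isCode A n = does (em {P = HasCode A n})

  isCode-cong : ∀ {A B} → A ⊆ B → B ⊆ A → isCode A ≗ isCode B
  isCode-cong A⊆B B⊆A n = does-⇔ (mk⇔ (HasCode-mono A⊆B) (HasCode-mono B⊆A)) em em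
    where
    HasCode-mono : ∀ {A B} → A ⊆ B → HasCode A n → HasCode B n
    HasCode-mono A⊆B (a , (q∈A , i≤) , eq) = a , (A⊆B q∈A , i≤) , eq

  -- The number of points of L_A whose code is smaller than that of a.

  rank : Pred ℚ 0ℓ → Point → ℕ
  rank A a = count (isCode A) (codeᴾ a)

  isCode-∈ : ∀ {A a} → a ∈ Blocks A → isCode A (codeᴾ a) ≡ true
  isCode-∈ {a = a} a∈ = dec-true em (a , a∈ , refl)

  rank-injective : ∀ A {a b} → a ∈ Blocks A → b ∈ Blocks A → rank A a ≡ rank A b → a ≡ b
  rank-injective A {a} {b} a∈ b∈ eq = codeᴾ-injective {a} {b}
    (count-injective (isCode A) (isCode-∈ {A} {a} a∈) (isCode-∈ {A} {b} b∈) eq)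

  module _ (A : Pred ℚ 0ℓ) (nonempty : Satisfiable A) where

    codes-unbounded : ∀ n → ∃[ m ] n ≤ m × isCode A m ≡ true
    codes-unbounded n = codeᴾ a , n≤code , isCode-∈ {A} {a} (proj₂ nonempty , z≤n)
      where
      -- The second index is free, so L_A is infinite even if A is not.
      a : Point
      a = (proj₁ nonempty , fromℤ (+ n)) , 0

      n≤code : n ≤ codeᴾ a
      n≤code = ℕ.≤-trans (n≤pair 0 n) (ℕ.≤-trans (n≤pair 0 (pair 0 n))
        (ℕ.≤-trans (n≤pair (codeℚ (proj₁ nonempty)) _) (n≤pair 0 _)))

    ranked : ∀ n → ∃[ a ] a ∈ Blocks A × rank A a ≡ n
    ranked n with m , dm , eq ← nth (isCode A) codes-unbounded n with em {P = HasCode A m}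
    ... | yes (a , a∈ , refl) = a , a∈ , eq
    ... | no _ with () ← dm

    -- The point of L_A of rank n.

    point : ℕ → Point
    point n = proj₁ (ranked n)

    point-∈ : ∀ n → point n ∈ Blocks A
    point-∈ n = proj₁ (proj₂ (ranked n))

    point-rank : ∀ n → rank A (point n) ≡ n
    point-rank n = proj₂ (proj₂ (ranked n))

    opaque
      -- The order L_A, with n standing for the point of rank n.  It is opaque:
      -- realises and orderOf-cong are all that is needed of it.

      orderOf : LO
      orderOf = R , record
        { support = λ _ → tt , tt
        ; reflx   = λ _ → fromWitness ≤ᴾ-refl
        ; antisym = λ {m} {n} m≤n n≤m → trans (sym (point-rank m)) (trans
            (cong (rank A) (≤ᴾ-antisym (toWitness m≤n) (toWitness n≤m))) (point-rank n))
        ; transit = λ {l} {m} {n} l≤m m≤n →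
            fromWitness (≤ᴾ-trans {point l} {point m} {point n} (toWitness l≤m) (toWitness m≤n))
        ; total   = λ {m} {n} _ _ → ⊎-map fromWitness fromWitness (≤ᴾ-total (point m) (point n))
        }
        where
        R : Code
        R m n = ⌊ point m ≤ᴾ? point n ⌋

    opaque
      unfolding orderOf

      -- Stated for every code pointwise equal to that of L_A, which is what
      -- membership in the antichain provides.

      realises : (L : LO) → Setoid._≈_ LO-setoid L orderOf → Realises A (order (LO⇒Lin L))
      realises (R , lo) R≈ = record
        { label        = point ∘ proj₁
        ; label-mono   = λ {x} {y} h → toWitness (subst T (R≈ (proj₁ x) (proj₁ y)) h)
        ; label-cancel = λ {x} {y} h → subst T (sym (R≈ (proj₁ x) (proj₁ y))) (fromWitness h)
        ; label-∈      = λ x → point-∈ (proj₁ x)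
        ; label-onto   = λ a a∈ → (rank A a , IsLinearOn.reflx lo tt) ,
            rank-injective A (point-∈ (rank A a)) a∈ (point-rank (rank A a))
        }

  opaque
    unfolding orderOf

    -- The points of given rank in L_A and L_B agree when A = B, whatever witnesses
    -- of nonemptiness are used.

    orderOf-cong : ∀ {A B} neA neB → A ⊆ B → B ⊆ A →
                   Setoid._≈_ LO-setoid (orderOf A neA) (orderOf B neB)
    orderOf-cong {A} {B} neA neB A⊆B B⊆A m n =
      cong₂ (λ a b → ⌊ a ≤ᴾ? b ⌋) (point-cong m) (point-cong n)
      where
      point-cong : point A neA ≗ point B neB
      point-cong n = rank-injective B
        (A⊆B (proj₁ (point-∈ A neA n)) , proj₂ (point-∈ A neA n)) (point-∈ B neB n)
        (begin
          rank B (point A neA n) ≡⟨ count-cong (isCode-cong A⊆B B⊆A) (codeᴾ (point A neA n)) ⟨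
          rank A (point A neA n) ≡⟨ point-rank A neA n ⟩
          n                      ≡⟨ point-rank B neB n ⟨
          rank B (point B neB n) ∎)
        where open ≡-Reasoning

-- Pairwise incomparable sets of rationals

-- n or - (n + 1), according to the Boolean.

sign : Bool → ℕ → ℤ
sign true  n = + n
sign false n = -[1+ n ]

sign-injective : ∀ b c {m n} → sign b m ≡ sign c n → b ≡ c × m ≡ n
sign-injective true  true  refl = refl , refl
sign-injective false false refl = refl , refl

-- The set A_s of the integers sign (s n) n.

Signed : (ℕ → Bool) → Pred ℚ 0ℓ
Signed s q = ∃[ n ] q ≡ fromℤ (sign (s n) n)

Signed-nonempty : ∀ s → Satisfiable (Signed s)
Signed-nonempty s = fromℤ (sign (s 0) 0) , 0 , refl

Signed-cong : ∀ {s t} → s ≗ t → Signed s ⊆ Signed t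
Signed-cong s≗t (n , eq) = n , trans eq (cong (λ b → fromℤ (sign b n)) (s≗t n))

Signed-⊆ : ∀ {s t} → Signed s ⊆ Signed t → s ≗ t
Signed-⊆ {s} {t} s⊆t n
  with m , eq ← s⊆t {fromℤ (sign (s n) n)} (n , refl)
  with b≡c , refl ← sign-injective (s n) (t m) (cong ℚ.numerator eq) = b≡c

-- The chain and the antichain

theorem5p2 : (∀ {a : Level} → ExcludedMiddle a) →
    ∀ {ℓ : Level} (ℒ : Pred Lin ℓ) →
    ℒ ⊆ Scat →
    Satisfiable ℒ →
    DownwardClosed ℒ →
    ClosedUnderConvexSums ℒ →
    RealChain ℒ × ContinuumAntichain ℒ
theorem5p2 em ℒ ℒ⊆Scat nonempty closed _ = chain , antichain
  where
  open Coding em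
  open Setoid LO-setoid using () renaming (_≈_ to _≈ᴸᴼ_; refl to ≈-refl)

  one∈ℒ : singleton ∈ ℒ
  one∈ℒ = singleton∈ nonempty closed

  cutOrder : ℝ → LO
  cutOrder x = orderOf (ℝ.cut x) (ℝ.nonempty x)

  cut-realised : ∀ x → Realises (ℝ.cut x) (order (LO⇒Lin (cutOrder x)))
  cut-realised x = realises (ℝ.cut x) (ℝ.nonempty x) (cutOrder x) (≈-refl {cutOrder x})

  chain : RealChain ℒ
  chain =
    record
      { to   = cutOrder
      ; cong = λ {x} {y} (x≤y , y≤x) → orderOf-cong (ℝ.nonempty x) (ℝ.nonempty y) x≤y y≤x
      } ,
    λ x y → mk⇔
      (⊴⇒⊆ em ℒ⊆Scat (LO⇒Lin (cutOrder x)) (LO⇒Lin (cutOrder y))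
         (cut-realised x) (cut-realised y))
      (λ x≤y → initial⇒⊴ one∈ℒ (LO⇒Lin (cutOrder x)) (LO⇒Lin (cutOrder y))
         (cut-realised x) (cut-realised y) x≤y (λ p≤q _ → ℝ.lower x p≤q))

  signedOrder : (ℕ → Bool) → LO
  signedOrder s = orderOf (Signed s) (Signed-nonempty s)

  signedOrder-cong : ∀ {s t} → s ≗ t → signedOrder s ≈ᴸᴼ signedOrder t
  signedOrder-cong {s} {t} s≗t = orderOf-cong (Signed-nonempty s) (Signed-nonempty t)
    (Signed-cong s≗t) (Signed-cong (sym ∘ s≗t))

  signed-realised : ∀ s L → L ≈ᴸᴼ signedOrder s → Realises (Signed s) (order (LO⇒Lin L))
  signed-realised s = realises (Signed s) (Signed-nonempty s)

  ⊴⇒≗ : ∀ {s t} L L′ → L ≈ᴸᴼ signedOrder s → L′ ≈ᴸᴼ signedOrder t → L ⊴LO[ ℒ ] L′ → s ≗ t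
  ⊴⇒≗ {s} {t} L L′ L≈ L′≈ L⊴L′ = Signed-⊆ (⊴⇒⊆ em ℒ⊆Scat (LO⇒Lin L) (LO⇒Lin L′)
    (signed-realised s L L≈) (signed-realised t L′ L′≈) L⊴L′)

  A : Pred LO 0ℓ
  A L = ∃[ s ] L ≈ᴸᴼ signedOrder s

  ≗⇒≈ : ∀ {s t} L L′ → L ≈ᴸᴼ signedOrder s → L′ ≈ᴸᴼ signedOrder t → s ≗ t → L ≈ᴸᴼ L′
  ≗⇒≈ L L′ L≈ L′≈ s≗t m n =
    trans (L≈ m n) (trans (signedOrder-cong s≗t m n) (sym (L′≈ m n)))

  incomparable : IsAntichain ℒ A
  incomparable {L} {L′} (s , L≈) (t , L′≈) L≉L′ =
    (λ L⊴L′ → L≉L′ (≗⇒≈ L L′ L≈ L′≈ (⊴⇒≗ L L′ L≈ L′≈ L⊴L′))) ,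
    (λ L′⊴L → L≉L′ (≗⇒≈ L L′ L≈ L′≈ (sym ∘ ⊴⇒≗ L′ L L′≈ L≈ L′⊴L)))

  antichain : ContinuumAntichain ℒ
  antichain = A , (λ {L} {L′} → incomparable {L} {L′}) , record
    { to        = λ s → signedOrder s , s , ≈-refl {signedOrder s}
    ; cong      = signedOrder-cong
    ; bijective = (λ {s} {t} → signedOrder-injective s t) ,
        λ (L , s , L≈) → s , λ {t} t≗s →
          ≗⇒≈ (signedOrder t) L (≈-refl {signedOrder t}) L≈ t≗s
    }
    where
    -- If the two orders are equal then the first one realises both sets, and
    -- it is below itself.
    signedOrder-injective : ∀ s t → signedOrder s ≈ᴸᴼ signedOrder t → s ≗ t
    signedOrder-injective s t s≈t =
      ⊴⇒≗ L L (≈-refl {L}) s≈t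
        (initial⇒⊴ one∈ℒ (LO⇒Lin L) (LO⇒Lin L) L-realised L-realised id (λ _ p∈ _ → p∈))
      where
      L = signedOrder s
      L-realised = signed-realised s L (≈-refl {L})
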